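{- Let $p\ge 2$ be an even integer, $m\ge 3$ an odd integer, and let $G$ be a $(p,q)$-graph with $V(G)=\{u_i \mid 1\le i\le p\}$. Suppose the following three conditions hold. (a) For some $t\ge 2$, $G$ is a $t$-partite graph with partite sets $V_l$, $1\le l\le t$, such that $|V_l|=s_l$ with $s_{l+1}\ge s_l\ge 1$. (b) $G$ admits a bijective total labeling $g:V(G)\cup E(G)\to[1,p+q]$, with induced color of $u$ given by $g^+_{tn}(u)=\sum_{x\in N(u)}[g(ux)+g(x)]$, such that for each $1\le l\le t$: if $s_l=1$, then the only induced color in $V_l$ is $\alpha_l$; and if $s_l\ge 2$, then all the induced colors of the vertices of $V_l$ form (in some order) an arithmetic sequence with first term $\alpha_l$ and common difference $d_l$. (A) There exists a $p\times m$ matrix $A_{p\times m}$ whose set of entries is $[1,pm]$, all of whose column sums are equal to the constant $p(pm+1)/2$, and whose $p$ row sums (one for each row) can be partitioned into $t$ collections $S_l$, $1\le l\le t$, with $S_l$ of size $s_l$, such that: if $s_l=1$, then the only element of $S_l$ is $\beta_l$; and if $s_l\ge 2$, then all the elements of $S_l$ form (in some order) an arithmetic sequence with first term $\beta_l$ and common difference $-d_l$. Suppose moreover that (i) $\alpha_l+\beta_l\ne\alpha_{l'}+\beta_{l'}$ for all $1\le l<l'\le t$, and (ii) for all $1\le l\le t$, $$\alpha_l+\beta_l+m(2p+2q+pm)+\frac{m(m+1)}{2}\ne\sum_{i=1}^p g(u_i)+\frac{p(pm+1)}{2}+p(p+q).$$ Then $\chi_{ltna}(G\vee O_m)\le t+1$.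 Equality holds if $\chi(G)=t$.
   Context: All graphs are finite and simple. A $(p,q)$-graph is a graph with $p$ vertices and $q$ edges. For integers $a<b$, $[a,b]=\{a,a+1,\dots,b\}$. $N(u)$ is the set of neighbors of $u$; $\chi$ is the chromatic number. $O_m$ is the null (edgeless) graph on $m$ vertices. The join $G\vee H$ of (vertex-disjoint) graphs has $V(G\vee H)=V(G)\cup V(H)$ and $E(G\vee H)=E(G)\cup E(H)\cup\{uv\mid u\in V(G),v\in V(H)\}$. For a graph $G=(V,E)$ of order $p$ and size $q$, a bijective total labeling is a bijection $f:V\cup E\to\{1,\dots,p+q\}$; its induced vertex coloring is $f^+_{tn}(u)=\sum_{ux\in E}[f(ux)+f(x)]$, with $f^+_{tn}(u)=0$ if $u$ is isolated. Such an $f$ is a local total neighborhood antimagic labeling of $G$ if $f^+_{tn}(u)\ne f^+_{tn}(v)$ for every edge $uv\in E$. The number of distinct induced colors is $c_{tn}(f)$. The local total neighborhood antimagic chromatic number $\chi_{ltna}(G)$ is the minimum of $c_{tn}(f)$ over all local total neighborhood antimagic labelings $f$ of $G$. It is considered for graphs of order at least 2 without isolated vertices that admit such a labeling; thus an assertion $\chi_{ltna}(G)\le k$ or $\chi_{ltna}(G)=k$ includes the assertion that $G$ admits such a labeling. -}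

module Defs where

open import Algebra.Properties.CommutativeMonoid.Sum using (sum)
open import Data.Empty using (⊥)
open import Data.Fin.Base as Fin using (Fin; toℕ; splitAt)
import Data.Fin.Properties as Fin
open import Data.Integer.Base as ℤ using (ℤ; +_)
open import Data.List.Base using (List; length; filter; map; upTo; allFin; cartesianProduct; deduplicate)
open import Data.Nat.Base using (ℕ; suc; _+_; _*_; _≤_)
open import Data.Nat.Properties using (+-0-commutativeMonoid; _≟_)
open import Data.Product.Base using (_×_; _,_; ∃-syntax)
open import Data.Sum.Base using (_⊎_; inj₁; inj₂)
open import Data.Unit.Base using (⊤; tt)
open import Data.Vec.Functional using (Vector)
open import Function.Base using (_∘_)
open import Function.Bundles using (_⤖_; Bijection)
open import Level using (0ℓ)
open import Relation.Binary.Core using (Rel)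
open import Relation.Binary.Definitions using (Decidable; Irreflexive; Symmetric; tri<; tri≈; tri>)
open import Relation.Binary.PropositionalEquality using (_≡_; _≢_; refl)
open import Relation.Nullary.Decidable using (Dec; yes; no; _×-dec_)
open import Relation.Nullary.Negation using (contradiction-irr; ¬_)

∑ : ∀ {n} → Vector ℕ n → ℕ
∑ = sum +-0-commutativeMonoid

-- Finite simple graphs of order n, with vertex set Fin n.

record Graph (n : ℕ) : Set₁ where
  field
    Adj    : Rel (Fin n) 0ℓ
    adj?   : Decidable Adj
    symm   : Symmetric Adj
    irrefl : Irreflexive _≡_ Adj

-- An edge is an unordered pair, represented by its increasing ordering.
-- The proofs are irrelevant, so an edge is determined by its endpoints.

record Edge {n} (G : Graph n) : Set where
  constructor mkEdge
  open Graph G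
  field
    src tgt   : Fin n
    .src<tgt  : src Fin.< tgt
    .adjacent : Adj src tgt

edge : ∀ {n} (G : Graph n) (u v : Fin n) → Graph.Adj G u v → Edge G
edge G u v uv with Fin.<-cmp u v
... | tri< u<v _ _ = mkEdge u v u<v uv
... | tri≈ _ u≡v _ = contradiction-irr uv (Graph.irrefl G u≡v)
... | tri> _ _ v<u = mkEdge v u v<u (Graph.symm G uv)

size : ∀ {n} → Graph n → ℕ
size {n} G = length (filter (λ (u , v) → (u Fin.<? v) ×-dec Graph.adj? G u v)
                            (cartesianProduct (allFin n) (allFin n)))

O : ∀ m → Graph m
O m = record
  { Adj    = λ _ _ → ⊥
  ; adj?   = λ _ _ → no λ ()
  ; symm   = λ ()
  ; irrefl = λ _ ()
  }

-- The first m vertices of the join are those of G, the last n those of H.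

module _ {m n} (G : Graph m) (H : Graph n) where

  private
    module G = Graph G
    module H = Graph H

  JoinAdj : Rel (Fin m ⊎ Fin n) 0ℓ
  JoinAdj (inj₁ u) (inj₁ v) = G.Adj u v
  JoinAdj (inj₁ u) (inj₂ v) = ⊤
  JoinAdj (inj₂ u) (inj₁ v) = ⊤
  JoinAdj (inj₂ u) (inj₂ v) = H.Adj u v

  joinAdj? : Decidable JoinAdj
  joinAdj? (inj₁ u) (inj₁ v) = G.adj? u v
  joinAdj? (inj₁ u) (inj₂ v) = yes tt
  joinAdj? (inj₂ u) (inj₁ v) = yes tt
  joinAdj? (inj₂ u) (inj₂ v) = H.adj? u v

  joinAdj-symm : Symmetric JoinAdj
  joinAdj-symm {inj₁ u} {inj₁ v} uv = G.symm uv
  joinAdj-symm {inj₁ u} {inj₂ v} _  = tt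
  joinAdj-symm {inj₂ u} {inj₁ v} _  = tt
  joinAdj-symm {inj₂ u} {inj₂ v} uv = H.symm uv

  joinAdj-irrefl : Irreflexive _≡_ JoinAdj
  joinAdj-irrefl {inj₁ u} refl = G.irrefl refl
  joinAdj-irrefl {inj₂ u} refl = H.irrefl refl

  infixr 6 _∨_

  _∨_ : Graph (m + n)
  _∨_ = record
    { Adj    = λ u v → JoinAdj (splitAt m u) (splitAt m v)
    ; adj?   = λ u v → joinAdj? (splitAt m u) (splitAt m v)
    ; symm   = λ {u} {v} → joinAdj-symm {splitAt m u} {splitAt m v}
    ; irrefl = λ { {u} refl → joinAdj-irrefl {splitAt m u} refl }
    }

IsMinimum : (ℕ → Set) → ℕ → Set
IsMinimum P k = P k × (∀ j → P j → k ≤ j)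

ProperColouring : ∀ {n} {C : Set} → Graph n → (Fin n → C) → Set
ProperColouring G c = ∀ u v → Graph.Adj G u v → c u ≢ c v

Colourable : ∀ {n} → Graph n → ℕ → Set
Colourable {n} G k = ∃[ c ] ProperColouring {n} {Fin k} G c

IsChromaticNumber : ∀ {n} → Graph n → ℕ → Set
IsChromaticNumber G = IsMinimum (Colourable G)

-- The element i of Fin (n + size G) stands for the label i + 1.

TotalLabelling : ∀ {n} → Graph n → Set
TotalLabelling {n} G = (Fin n ⊎ Edge G) ⤖ Fin (n + size G)

module _ {n} {G : Graph n} (f : TotalLabelling G) where

  open Graph G

  vertexLabel : Fin n → ℕ
  vertexLabel u = suc (toℕ (Bijection.to f (inj₁ u)))

  edgeLabel : Edge G → ℕ
  edgeLabel e = suc (toℕ (Bijection.to f (inj₂ e)))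

  contribution : (u x : Fin n) → Dec (Adj u x) → ℕ
  contribution u x (yes ux) = edgeLabel (edge G u x ux) + vertexLabel x
  contribution u x (no  _)  = 0

  inducedColour : Fin n → ℕ
  inducedColour u = ∑ (λ x → contribution u x (adj? u x))

  IsLocalTotalNeighbourhoodAntimagic : Set
  IsLocalTotalNeighbourhoodAntimagic = ProperColouring G inducedColour

  colourCount : ℕ
  colourCount = length (deduplicate _≟_ (map inducedColour (allFin n)))

IsLtnaChromaticNumber : ∀ {n} → Graph n → ℕ → Set
IsLtnaChromaticNumber G = IsMinimum λ k →
  ∃[ f ] IsLocalTotalNeighbourhoodAntimagic {G = G} f × colourCount f ≡ k

-- The elements of the block with index l, when Fin n is partitioned into t
-- (possibly empty) indexed blocks by a map to Fin t.

block : ∀ {n t} → (Fin n → Fin t) → Fin t → List (Fin n)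
block {n} π l = filter (λ u → π u Fin.≟ l) (allFin n)

-- Of length k; for k = 1 it is just a, whatever d is.

arithmeticSequence : (a d : ℤ) (k : ℕ) → List ℤ
arithmeticSequence a d k = map (λ i → a ℤ.+ + i ℤ.* d) (upTo k)

Matrix : ℕ → ℕ → Set
Matrix m n = Fin m → Fin n → ℕ

rowSum : ∀ {m n} → Matrix m n → Fin m → ℕ
rowSum A i = ∑ (λ j → A i j)

columnSum : ∀ {m n} → Matrix m n → Fin n → ℕ
columnSum A j = ∑ (λ i → A i j)

{-# OPTIONS --safe #-}
module Submission where

import Algebra.Properties.AbelianGroup as AbelianGroupProperties
import Algebra.Properties.CommutativeMonoid.Sum as CommutativeMonoidSum
open import Data.Empty using (⊥-elim-irr)
open import Data.Fin.Base as Fin using (Fin; zero; suc; toℕ; splitAt; join; _↑ˡ_; _↑ʳ_; fromℕ<; punchOut)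
import Data.Fin.Permutation as Perm
import Data.Fin.Properties as Fin
open import Data.Integer.Base as ℤ using (ℤ; +_)
import Data.Integer.Properties as ℤ
import Data.Integer.Tactic.RingSolver as ℤRing
open import Data.List.Base using
  (List; _∷_; length; map; lookup; filter; allFin; cartesianProduct; deduplicate; upTo)
open import Data.List.Properties using (∷-injective; map-cong; lookup-upTo; length-map; length-upTo)
open import Data.List.Membership.Propositional using (_∈_)
open import Data.List.Membership.Propositional.Properties
open import Data.List.Relation.Binary.Permutation.Propositional using (_↭_; ↭-sym; ↭⇒↭ₛ)
open import Data.List.Relation.Binary.Permutation.Propositional.Properties using (↭-map-inv; ∈-resp-↭)
import Data.List.Relation.Binary.Permutation.Setoid.Properties as ↭ₛ
open import Data.List.Relation.Unary.All as All using (_∷_)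
open import Data.List.Relation.Unary.AllPairs using (_∷_)
open import Data.List.Relation.Unary.Any using (index)
open import Data.List.Relation.Unary.Any.Properties using (lookup-index)
open import Data.List.Relation.Unary.Unique.Propositional using (Unique)
import Data.List.Relation.Unary.Unique.Propositional.Properties as Unique
open import Data.List.Relation.Unary.Unique.DecPropositional.Properties using (deduplicate-!)
open import Data.Nat.Base using (ℕ; zero; suc; _+_; _*_; _≤_; _<_; s≤s; z≤n)
open import Data.Nat.DivMod using (_/_; m*n/n≡m; /-congˡ)
open import Data.Nat.Divisibility using (_∣_)
open import Data.Nat.Induction using (<-rec)
open import Data.Nat.Properties using
  (_≟_; +-0-commutativeMonoid; anyUpTo?; ≮⇒≥; <⇒≤; ≤-trans; ≤-refl; ≤-reflexive; <-irrefl; <-asym;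
   m≤m+n; +-assoc; +-comm; +-identityʳ; suc-injective; +-suc; ≤-antisym)
open import Data.Nat.Tactic.RingSolver using (solve-∀)
open import Data.Product.Base using (Σ; _×_; _,_; ∃; ∃-syntax; proj₁; proj₂)
open import Data.Sum.Base using (_⊎_; inj₁; inj₂)
open import Data.Sum.Function.Propositional using (_⊎-↔_)
open import Data.Unit.Base using (tt)
open import Data.Vec.Functional as Vector using (Vector)
open import Function.Base using (_∘_; id)
open import Function.Bundles using (_⇔_; _⤖_; _↔_; Bijection; Inverse; Equivalence; mk⤖; mk↔ₛ′)
open import Function.Consequences.Propositional using (strictlySurjective⇒surjective)
open import Function.Construct.Composition using (_↔-∘_)
open import Function.Construct.Identity using (↔-id)
open import Function.Construct.Symmetry using (↔-sym)
open import Function.Definitions using (Injective; StrictlySurjective)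
open import Function.Properties.Bijection using (⤖⇒↔)
open import Function.Properties.Inverse using (↔⇒⤖)
open import Relation.Binary.Definitions using (tri<; tri≈; tri>)
open import Relation.Binary.PropositionalEquality using
  (_≡_; _≢_; _≗_; refl; sym; trans; cong; cong₂; subst; subst₂; setoid; module ≡-Reasoning)
open import Relation.Nullary.Decidable using (Dec; yes; no; map′; _×-dec_; _→-dec_; ¬?; recompute)
open import Relation.Nullary.Negation using (¬_; contradiction; contradiction-irr)
open import Relation.Unary using (Decidable)
open import Defs

-- Give G its labels g, give the edge u_i v_j the label p + q + A (σ i) j, and
-- give v_j the label p + q + pm + j, where the permutation σ of the rows makes
-- the progressions of step d_l and −d_l run in parallel. All of V_l then gets
-- one colour and all of O_m another, so t + 1 colours occur at most; the
-- minimum exists because the labellings of a graph can be searched.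
-- Conversely any such labelling colours G ∨ O_m properly, and O_m uses a colour
-- that G cannot, so at least χ(G) + 1 colours occur.

module Sum = CommutativeMonoidSum +-0-commutativeMonoid
module ℤ+ = AbelianGroupProperties ℤ.+-0-abelianGroup

-- Bijections and exhaustive search on finite sets.

mk⤖ₛ : ∀ {A B : Set} (f : A → B) → Injective _≡_ _≡_ f → StrictlySurjective _≡_ f → A ⤖ B
mk⤖ₛ f inj surj = mk⤖ {to = f} (inj , strictlySurjective⇒surjective surj)

-- Pigeonhole: were `y` missed, punching it out of the codomain would inject `Fin (suc n)` into
-- `Fin n`.
injective⇒surjective : ∀ {n} {f : Fin n → Fin n} → Injective _≡_ _≡_ f → StrictlySurjective _≡_ f
injective⇒surjective {suc n} {f} inj y with Fin.any? (λ x → f x Fin.≟ y)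
... | yes hit = hit
... | no miss = contradiction (Fin.injective⇒≤ squeezed) (<-irrefl refl)
  where
  avoid : ∀ x → y ≢ f x
  avoid x y≡fx = miss (x , sym y≡fx)

  squeezed : Injective _≡_ _≡_ (λ x → punchOut (avoid x))
  squeezed eq = inj (Fin.punchOut-injective (avoid _) (avoid _) eq)

-- A choice of preimages `s` is injective, hence surjective. So `x` and `y` are themselves chosen
-- preimages, and such elements are determined by their images.
surjective⇒injective : ∀ {n} {f : Fin n → Fin n} → StrictlySurjective _≡_ f → Injective _≡_ _≡_ f
surjective⇒injective {f = f} surj {x} {y} fx≡fy =
  trans (sym sa≡x) (trans (cong s a≡b) sb≡y)
  where
  s = proj₁ ∘ surj

  s-injective : Injective _≡_ _≡_ s
  s-injective {a} {b} eq = trans (sym (proj₂ (surj a))) (trans (cong f eq) (proj₂ (surj b)))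

  a = proj₁ (injective⇒surjective s-injective x)
  b = proj₁ (injective⇒surjective s-injective y)
  sa≡x = proj₂ (injective⇒surjective s-injective x)
  sb≡y = proj₂ (injective⇒surjective s-injective y)

  a≡b : a ≡ b
  a≡b = trans (sym (proj₂ (surj a)))
    (trans (cong f sa≡x) (trans fx≡fy (trans (cong f (sym sb≡y)) (proj₂ (surj b)))))

-- Transport along `e` reduces this to endofunctions of `Fin n`. Labellings can thus be built from a
-- surjectivity check alone.
surjective⇒⤖ : ∀ {n} {X : Set} → Fin n ↔ X → (f : X → Fin n) → StrictlySurjective _≡_ f → X ⤖ Fin n
surjective⇒⤖ {n} {X} e f surj = mk⤖ₛ f inj surj
  where
  open Inverse e

  f∘e-surjective : StrictlySurjective _≡_ (f ∘ to)
  f∘e-surjective y with surj y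
  ... | x , fx≡y = from x , trans (cong f (strictlyInverseˡ x)) fx≡y

  inj : Injective _≡_ _≡_ f
  inj {x} {y} fx≡fy = trans (sym (strictlyInverseˡ x)) (trans (cong to eq) (strictlyInverseˡ y))
    where
    eq : from x ≡ from y
    eq = surjective⇒injective f∘e-surjective
      (trans (cong f (strictlyInverseˡ x)) (trans fx≡fy (cong f (sym (strictlyInverseˡ y)))))

-- Recursion on the size of the domain, choosing the first value and then the rest. A function
-- agrees with its head and tail put together only pointwise, whence the assumption that `P`
-- respects `≗`.
anyFunction? : ∀ {n} k {P : (Fin k → Fin n) → Set} → (∀ {f g} → f ≗ g → P f → P g) →
               Decidable P → Dec (∃ P)
anyFunction? zero    resp P? = map′ (_ ,_) (λ (f , Pf) → resp (λ ()) Pf) (P? λ ())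
anyFunction? (suc k) {P} resp P? =
  map′ (λ (x , f , Pxf) → x Vector.∷ f , Pxf)
       (λ (f , Pf) → Vector.head f , Vector.tail f , resp (λ { zero → refl ; (suc i) → refl }) Pf)
       (Fin.any? λ x → anyFunction? k {λ f → P (x Vector.∷ f)} (λ f≗g → resp λ { zero → refl ; (suc i) → f≗g i })
                                     (λ f → P? (x Vector.∷ f)))

-- Strong induction: either a smaller witness exists and the search restarts from it, or `k` itself
-- is least.
minimum : {P : ℕ → Set} → Decidable P → ∀ k → P k → ∃[ j ] IsMinimum P j × j ≤ k
minimum {P} P? = <-rec (λ k → P k → ∃[ j ] IsMinimum P j × j ≤ k) step
  where
  step : ∀ k → (∀ {i} → i < k → P i → ∃[ j ] IsMinimum P j × j ≤ i) → P k → ∃[ j ] IsMinimum P j × j ≤ k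
  step k rec Pk with anyUpTo? P? k
  ... | yes (i , i<k , Pi) with rec i<k Pi
  ...   | j , min , j≤i = j , min , ≤-trans j≤i (<⇒≤ i<k)
  step k rec Pk | no none = k , (Pk , λ j Pj → ≮⇒≥ λ j<k → none (j , j<k , Pj)) , ≤-refl

-- Lists without repetition and finite sums.

lookup-injective : {A : Set} {xs : List A} → Unique xs → Injective _≡_ _≡_ (lookup xs)
lookup-injective (_ ∷ _)       {zero}  {zero}  _  = refl
lookup-injective (x∉xs ∷ _)    {zero}  {suc j} eq = contradiction eq (All.lookup x∉xs (∈-lookup j))
lookup-injective (x∉xs ∷ _)    {suc i} {zero}  eq = contradiction (sym eq) (All.lookup x∉xs (∈-lookup i))
lookup-injective (_ ∷ unique)  {suc i} {suc j} eq = cong suc (lookup-injective unique eq)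

-- The two lists are not known to have definitionally equal lengths, so positions are compared
-- through `toℕ`.
lookup-map-≡ : {A B C : Set} {f : A → C} {g : B → C} {xs : List A} {ys : List B} →
               map f xs ≡ map g ys → ∀ i j → toℕ i ≡ toℕ j → f (lookup xs i) ≡ g (lookup ys j)
lookup-map-≡ {xs = x ∷ xs} {y ∷ ys} eq zero    zero    _   = proj₁ (∷-injective eq)
lookup-map-≡ {xs = x ∷ xs} {y ∷ ys} eq (suc i) (suc j) i≡j = lookup-map-≡ (proj₂ (∷-injective eq)) i j (suc-injective i≡j)

∑-const : ∀ n c → ∑ {n} (λ _ → c) ≡ n * c
∑-const zero    c = refl
∑-const (suc n) c = cong (_+_ c) (∑-const n c)

∑-shift : ∀ {n} c (v : Vector ℕ n) → ∑ (λ i → c + v i) ≡ n * c + ∑ v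
∑-shift {n} c v = trans (Sum.∑-distrib-+ (λ _ → c) v) (cong (_+ ∑ v) (∑-const n c))

∑-++ : ∀ m {n} (v : Vector ℕ (m + n)) → ∑ v ≡ ∑ (λ i → v (i ↑ˡ n)) + ∑ (λ j → v (m ↑ʳ j))
∑-++ zero    v = refl
∑-++ (suc m) v = trans (cong (_+_ (v zero)) (∑-++ m (v ∘ suc))) (sym (+-assoc (v zero) _ _))

∑-suc-toℕ : ∀ n → ∑ {n} (λ j → suc (toℕ j)) ≡ n * (n + 1) / 2
-- The induction proves the doubled identity, which is free of division; the factor 2 is cancelled
-- once at the end.
∑-suc-toℕ n = trans (sym (m*n/n≡m _ 2)) (/-congˡ (double n))
  where
  double : ∀ n → ∑ {n} (λ j → suc (toℕ j)) * 2 ≡ n * (n + 1)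
  double zero    = refl
  double (suc n) = begin
    suc (∑ {n} (λ j → 1 + suc (toℕ j))) * 2        ≡⟨ cong (λ T → suc T * 2) (∑-shift {n} 1 _) ⟩
    suc (n * 1 + S) * 2                            ≡⟨ split n S ⟩
    2 + 2 * n + S * 2                              ≡⟨ cong (_+_ (2 + 2 * n)) (double n) ⟩
    2 + 2 * n + n * (n + 1)                        ≡⟨ expand n ⟩
    suc n * (suc n + 1)                            ∎
    where
    open ≡-Reasoning
    S = ∑ {n} (λ j → suc (toℕ j))
    split : ∀ n S → suc (n * 1 + S) * 2 ≡ 2 + 2 * n + S * 2
    split = solve-∀
    expand : ∀ n → 2 + 2 * n + n * (n + 1) ≡ suc n * (suc n + 1)
    expand = solve-∀

-- Edges of a graph and their number.

module _ {n} {G : Graph n} where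

  open Graph G
  open Edge

  edge-≡ : {e e′ : Edge G} → src e ≡ src e′ → tgt e ≡ tgt e′ → e ≡ e′
  edge-≡ refl refl = refl

  -- Allows both orientations, so that an edge can be identified by its ends without knowing which
  -- is smaller.
  Joins : Edge G → Fin n → Fin n → Set
  Joins e u v = (src e ≡ u × tgt e ≡ v) ⊎ (src e ≡ v × tgt e ≡ u)

  joins-unique : ∀ e e′ {u v} → Joins e u v → Joins e′ u v → e ≡ e′
  joins-unique e e′ (inj₁ (refl , refl)) (inj₁ (p , q)) = edge-≡ (sym p) (sym q)
  joins-unique e e′ (inj₂ (refl , refl)) (inj₂ (p , q)) = edge-≡ (sym p) (sym q)
  -- Opposite orientations would make each end smaller than the other.
  joins-unique (mkEdge _ _ u<v _) (mkEdge _ _ v<u _) (inj₁ (refl , refl)) (inj₂ (refl , refl)) = ⊥-elim-irr (<-asym u<v v<u)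
  joins-unique (mkEdge _ _ u<v _) (mkEdge _ _ v<u _) (inj₂ (refl , refl)) (inj₁ (refl , refl)) = ⊥-elim-irr (<-asym u<v v<u)

  edge-joins : ∀ u v (uv : Adj u v) → Joins (edge G u v uv) u v
  edge-joins u v uv with Fin.<-cmp u v
  ... | tri< _ _ _   = inj₁ (refl , refl)
  ... | tri≈ _ u≡v _ = contradiction-irr uv (irrefl u≡v)
  ... | tri> _ _ _   = inj₂ (refl , refl)

-- `size` is the length of a list of pairs. That list has no repetition and contains every edge, so
-- its positions number the edges.
Fin↔Edge : ∀ {n} (G : Graph n) → Fin (size G) ↔ Edge G
Fin↔Edge {n} G = ⤖⇒↔ (mk⤖ₛ toEdge toEdge-injective toEdge-surjective)
  where
  open Graph G
  open Edge

  P? : Decidable (λ ((u , v) : Fin n × Fin n) → u Fin.< v × Adj u v)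
  P? (u , v) = (u Fin.<? v) ×-dec adj? u v

  pairs : List (Fin n × Fin n)
  pairs = filter P? (cartesianProduct (allFin n) (allFin n))

  pairs-unique : Unique pairs
  pairs-unique = Unique.filter⁺ P? (Unique.cartesianProduct⁺ (Unique.allFin⁺ n) (Unique.allFin⁺ n))

  isEdge : ∀ i → let (u , v) = lookup pairs i in u Fin.< v × Adj u v
  isEdge i = proj₂ (∈-filter⁻ P? {xs = cartesianProduct (allFin n) (allFin n)} (∈-lookup {xs = pairs} i))

  toEdge : Fin (size G) → Edge G
  toEdge i = mkEdge (proj₁ (lookup pairs i)) (proj₂ (lookup pairs i)) (proj₁ (isEdge i)) (proj₂ (isEdge i))

  toEdge-injective : Injective _≡_ _≡_ toEdge
  toEdge-injective eq = lookup-injective pairs-unique (cong₂ _,_ (cong src eq) (cong tgt eq))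

  toEdge-surjective : StrictlySurjective _≡_ toEdge
  toEdge-surjective (mkEdge u v u<v uv) = index uv∈ , edge-≡ (cong proj₁ (sym found)) (cong proj₂ (sym found))
    where
    uv∈ : (u , v) ∈ pairs
    -- The proofs stored in an edge are irrelevant; decidability recovers usable ones.
    uv∈ = ∈-filter⁺ P? (∈-cartesianProduct⁺ (∈-allFin u) (∈-allFin v))
                       (recompute (P? (u , v)) (u<v , uv))

    found : (u , v) ≡ lookup pairs (index uv∈)
    found = lookup-index uv∈

-- Induced colours, colour counts and proper colourings.

module _ {n} {G : Graph n} where

  open Graph G

  -- Leaving the decision `d` and the edge `e` arbitrary spares later proofs from evaluating `adj?`
  -- or the comparison inside `edge`.
  contribution-adjacent : (f : TotalLabelling G) {u x : Fin n} (d : Dec (Adj u x)) → Adj u x →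
                          (e : Edge G) → Joins e u x →
                          contribution f u x d ≡ edgeLabel f e + vertexLabel f x
  contribution-adjacent f (no ¬ux) ux e _ = contradiction ux ¬ux
  contribution-adjacent f {u} {x} (yes ux) _ e e-joins =
    cong (λ e′ → edgeLabel f e′ + vertexLabel f x)
         (joins-unique (edge G u x ux) e (edge-joins u x ux) e-joins)

  contribution-nonadjacent : (f : TotalLabelling G) {u x : Fin n} (d : Dec (Adj u x)) → ¬ Adj u x →
                             contribution f u x d ≡ 0
  contribution-nonadjacent f (yes ux) ¬ux = contradiction ux ¬ux
  contribution-nonadjacent f (no _)   _   = refl

  -- Choose a vertex for each colour that occurs. Its class determines its colour, so distinct
  -- colours yield distinct classes.
  colourCount-≤ : (f : TotalLabelling G) {k : ℕ} (c : Fin n → Fin k) →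
                  (∀ {u v} → c u ≡ c v → inducedColour f u ≡ inducedColour f v) →
                  colourCount f ≤ k
  colourCount-≤ f {k} c c-determines = Fin.injective⇒≤ {f = λ i → c (vertex i)} λ {i} {j} eq →
    lookup-injective (deduplicate-! _≟_ (map (inducedColour f) (allFin n)))
      (trans (vertex-colour i) (trans (c-determines eq) (sym (vertex-colour j))))
    where
    colours : List ℕ
    colours = deduplicate _≟_ (map (inducedColour f) (allFin n))

    attained : ∀ i → ∃[ u ] u ∈ allFin n × lookup colours i ≡ inducedColour f u
    attained i = ∈-map⁻ (inducedColour f) (∈-deduplicate⁻ _≟_ _ (∈-lookup {xs = colours} i))

    vertex : Fin (colourCount f) → Fin n
    vertex i = proj₁ (attained i)

    vertex-colour : ∀ i → lookup colours i ≡ inducedColour f (vertex i)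
    vertex-colour i = proj₂ (proj₂ (attained i))

  -- The position of a vertex's induced colour in the deduplicated list serves as its colour.
  antimagic⇒colourable : (f : TotalLabelling G) → IsLocalTotalNeighbourhoodAntimagic f →
                         Colourable G (colourCount f)
  antimagic⇒colourable f antimagic = (λ u → index (attains u)) , λ u v uv eq → antimagic u v uv
    (trans (lookup-index (attains u)) (trans (cong (lookup colours) eq) (sym (lookup-index (attains v)))))
    where
    colours : List ℕ
    colours = deduplicate _≟_ (map (inducedColour f) (allFin n))

    attains : ∀ u → inducedColour f u ∈ colours
    attains u = ∈-deduplicate⁺ _≟_ (∈-map⁺ (inducedColour f) (∈-allFin u))

-- Deciding which colour counts are attained.

Attains : ∀ {n} (G : Graph n) → ℕ → TotalLabelling G → Set
Attains G k f = IsLocalTotalNeighbourhoodAntimagic {G = G} f × colourCount f ≡ k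

module _ {n} {G : Graph n} where

  open Graph G

  Attains? : ∀ k → Decidable (Attains G k)
  Attains? k f = Fin.all? (λ u → Fin.all? λ v → adj? u v →-dec ¬? (inducedColour f u ≟ inducedColour f v))
                 ×-dec (colourCount f ≟ k)

  -- Labellings carry proofs, so two with the same values need not be equal; a search over value
  -- functions needs only this invariance.
  Attains-resp : ∀ {k} {f g : TotalLabelling G} → Bijection.to f ≗ Bijection.to g → Attains G k f → Attains G k g
  Attains-resp {k} {f} {g} f≗g (antimagic , count) =
    (λ u v uv eq → antimagic u v uv (trans (colours-≗ u) (trans eq (sym (colours-≗ v))))) ,
    trans (cong (length ∘ deduplicate _≟_) (sym (map-cong colours-≗ (allFin n)))) count
    where
    contribution-≡ : ∀ u x (d : Dec (Adj u x)) → contribution f u x d ≡ contribution g u x d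
    contribution-≡ u x (yes ux) = cong₂ (λ a b → suc (toℕ a) + suc (toℕ b)) (f≗g (inj₂ (edge G u x ux))) (f≗g (inj₁ x))
    contribution-≡ u x (no _)   = refl

    colours-≗ : inducedColour f ≗ inducedColour g
    colours-≗ u = Sum.sum-cong-≗ (λ x → contribution-≡ u x (adj? u x))

-- Along a fixed numbering of the elements of G, labellings become injective
-- endofunctions of a finite set, of which there are finitely many.
attainable? : ∀ {n} (G : Graph n) k → Dec (∃ (Attains G k))
attainable? {n} G k = map′ (λ (_ , f , _ , good) → f , good) encode
    (anyFunction? N {Encodes} (λ h≗h′ (f , f≗h , good) → f , (λ z → trans (f≗h z) (h≗h′ (E.from z))) , good)
                  encodes?)
  where
  N : ℕ
  N = n + size G

  elements : Fin N ↔ (Fin n ⊎ Edge G)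
  elements = (↔-id _ ⊎-↔ Fin↔Edge G) ↔-∘ Fin.+↔⊎

  module E = Inverse elements

  labelling : (h : Fin N → Fin N) → Injective _≡_ _≡_ h → TotalLabelling G
  labelling h inj = surjective⇒⤖ elements (h ∘ E.from) λ y →
    let x , hx≡y = injective⇒surjective inj y in E.to x , trans (cong h (E.strictlyInverseʳ x)) hx≡y

  Encodes : (Fin N → Fin N) → Set
  Encodes h = ∃[ f ] Bijection.to f ≗ h ∘ E.from × Attains G k f

  injective : ∀ {h} → Encodes h → Injective _≡_ _≡_ h
  injective {h} (f , f≗h , _) {x} {y} eq =
    trans (sym (E.strictlyInverseʳ x)) (trans (cong E.from (Bijection.injective f fx≡fy)) (E.strictlyInverseʳ y))
    where
    value : ∀ z → Bijection.to f (E.to z) ≡ h z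
    value z = trans (f≗h (E.to z)) (cong h (E.strictlyInverseʳ z))

    fx≡fy : Bijection.to f (E.to x) ≡ Bijection.to f (E.to y)
    fx≡fy = trans (value x) (trans eq (sym (value y)))

  encodes? : Decidable Encodes
  encodes? h with Fin.all? (λ x → Fin.all? λ y → (h x Fin.≟ h y) →-dec (x Fin.≟ y))
  ... | no ¬inj = no λ enc → ¬inj λ _ _ → injective enc
  -- Any labelling that `h` encodes has the same values as `f`, so testing `f` alone suffices.
  ... | yes inj = map′ (λ good → f , (λ _ → refl) , good)
                       (λ (f′ , f′≗h , good) → Attains-resp {f = f′} {f} f′≗h good)
                       (Attains? k f)
    where
    f = labelling h (inj _ _)

  encode : ∃ (Attains G k) → ∃ Encodes
  encode (f , good) = Bijection.to f ∘ E.to , f , (λ z → cong (Bijection.to f) (sym (E.strictlyInverseˡ z))) , good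

-- Edges and colourings of the join with a null graph.

module _ {p} (G : Graph p) (m : ℕ) where

  private
    J = G ∨ O m

  open Graph G
  open Edge

  -- Adjacency in the join is defined through `splitAt`, which does not reduce on these vertices;
  -- the equality moves between the two forms.
  Adj-join : ∀ z z′ → Graph.Adj J (join p m z) (join p m z′) ≡ JoinAdj G (O m) z z′
  Adj-join z z′ = cong₂ (JoinAdj G (O m)) (Fin.splitAt-join p m z) (Fin.splitAt-join p m z′)

  adjacent⁺ : ∀ z z′ → JoinAdj G (O m) z z′ → Graph.Adj J (join p m z) (join p m z′)
  adjacent⁺ z z′ = subst id (sym (Adj-join z z′))

  adjacent⁻ : ∀ z z′ → Graph.Adj J (join p m z) (join p m z′) → JoinAdj G (O m) z z′
  adjacent⁻ z z′ = subst id (Adj-join z z′)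

  ↑ˡ<↑ʳ : ∀ (i : Fin p) (j : Fin m) → i ↑ˡ m Fin.< p ↑ʳ j
  ↑ˡ<↑ʳ i j = subst₂ _<_ (sym (Fin.toℕ-↑ˡ i m)) (sym (Fin.toℕ-↑ʳ p j)) (≤-trans (Fin.toℕ<n i) (m≤m+n p (toℕ j)))

  ↑ˡ≢↑ʳ : ∀ (i : Fin p) (j : Fin m) → i ↑ˡ m ≢ p ↑ʳ j
  ↑ˡ≢↑ʳ i j eq = Fin.<-irrefl eq (↑ˡ<↑ʳ i j)

  ↑ˡ-mono-< : {u v : Fin p} → u Fin.< v → u ↑ˡ m Fin.< v ↑ˡ m
  ↑ˡ-mono-< {u} {v} = subst₂ _<_ (sym (Fin.toℕ-↑ˡ u m)) (sym (Fin.toℕ-↑ˡ v m))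

  ↑ˡ-cancel-< : {u v : Fin p} → u ↑ˡ m Fin.< v ↑ˡ m → u Fin.< v
  ↑ˡ-cancel-< {u} {v} = subst₂ _<_ (Fin.toℕ-↑ˡ u m) (Fin.toℕ-↑ˡ v m)

  -- The vertices of `G` come first, so a cross edge always has its source in `G`.
  joinEdge : Edge G ⊎ (Fin p × Fin m) → Edge J
  joinEdge (inj₁ (mkEdge u v u<v uv)) = mkEdge (u ↑ˡ m) (v ↑ˡ m) (↑ˡ-mono-< u<v) (adjacent⁺ (inj₁ u) (inj₁ v) uv)
  joinEdge (inj₂ (i , j))             = mkEdge (i ↑ˡ m) (p ↑ʳ j) (↑ˡ<↑ʳ i j) (adjacent⁺ (inj₁ i) (inj₂ j) tt)

  joinEdge-injective : Injective _≡_ _≡_ joinEdge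
  joinEdge-injective {inj₁ e} {inj₁ e′} eq = cong inj₁
    (edge-≡ (Fin.↑ˡ-injective m _ _ (cong src eq)) (Fin.↑ˡ-injective m _ _ (cong tgt eq)))
  joinEdge-injective {inj₁ e} {inj₂ (i , j)} eq = contradiction (cong tgt eq) (↑ˡ≢↑ʳ (tgt e) j)
  joinEdge-injective {inj₂ (i , j)} {inj₁ e} eq = contradiction (sym (cong tgt eq)) (↑ˡ≢↑ʳ (tgt e) j)
  joinEdge-injective {inj₂ (i , j)} {inj₂ (i′ , j′)} eq =
    cong inj₂ (cong₂ _,_ (Fin.↑ˡ-injective m i i′ (cong src eq)) (Fin.↑ʳ-injective p j j′ (cong tgt eq)))

  joinEdge-surjective : StrictlySurjective _≡_ joinEdge
  joinEdge-surjective (mkEdge x y x<y xy)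
    with covered (splitAt p x) (splitAt p y)
                 (subst₂ Fin._<_ (sym (Fin.join-splitAt p m x)) (sym (Fin.join-splitAt p m y)) x<y) xy
    where
    covered : ∀ z z′ → .(join p m z Fin.< join p m z′) → .(JoinAdj G (O m) z z′) →
              ∃[ e ] src (joinEdge e) ≡ join p m z × tgt (joinEdge e) ≡ join p m z′
    covered (inj₁ u) (inj₁ v) lt uv = inj₁ (mkEdge u v (↑ˡ-cancel-< lt) uv) , refl , refl
    covered (inj₁ i) (inj₂ j) lt _  = inj₂ (i , j) , refl , refl
    -- An increasing pair cannot start in the null graph and end in `G`.
    covered (inj₂ j) (inj₁ i) lt _  = ⊥-elim-irr (<-asym lt (↑ˡ<↑ʳ i j))
    covered (inj₂ _) (inj₂ _) _  ()
  ... | e , src≡ , tgt≡ =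
    e , edge-≡ (trans src≡ (Fin.join-splitAt p m x)) (trans tgt≡ (Fin.join-splitAt p m y))

  joinEdges : (Edge G ⊎ (Fin p × Fin m)) ↔ Edge J
  joinEdges = ⤖⇒↔ (mk⤖ₛ joinEdge joinEdge-injective joinEdge-surjective)

  -- Both sides count sets in bijection: an edge of the join is an edge of `G` or one of the `p * m`
  -- cross pairs.
  size-join : size J ≡ size G + p * m
  size-join = Perm.↔⇒≡
    (↔-sym Fin.+↔⊎ ↔-∘ ((↔-sym (Fin↔Edge G) ⊎-↔ ↔-sym Fin.*↔×) ↔-∘ (↔-sym joinEdges ↔-∘ Fin↔Edge J)))

  joinEdge-joinsˡ : ∀ {u v} e → Joins e u v → Joins (joinEdge (inj₁ e)) (u ↑ˡ m) (v ↑ˡ m)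
  joinEdge-joinsˡ e (inj₁ (refl , refl)) = inj₁ (refl , refl)
  joinEdge-joinsˡ e (inj₂ (refl , refl)) = inj₂ (refl , refl)

  -- All of O_m must avoid the colours of G, so one colour is left over for G.
  colourable-join : 1 ≤ m → ∀ {k} → Colourable J k → ∃[ k′ ] k ≡ suc k′ × Colourable G k′
  colourable-join 1≤m {zero} (c , _) with () ← c (p ↑ʳ fromℕ< 1≤m)
  colourable-join 1≤m {suc k} (c , proper) = k , refl , (λ u → punchOut (avoid u)) , λ u v uv eq →
    proper (u ↑ˡ m) (v ↑ˡ m) (adjacent⁺ (inj₁ u) (inj₁ v) uv) (Fin.punchOut-injective (avoid u) (avoid v) eq)
    where
    apex = fromℕ< 1≤m

    avoid : ∀ u → c (p ↑ʳ apex) ≢ c (u ↑ˡ m)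
    avoid u = proper (p ↑ʳ apex) (u ↑ˡ m) (adjacent⁺ (inj₂ apex) (inj₁ u) tt)

-- The labelling of the join and its induced colours.

module JoinLabelling {p m} {G : Graph p} (g : TotalLabelling G) (fill : (Fin p × Fin m) ⤖ Fin (p * m)) where

  private
    q = size G
    J = G ∨ O m

  -- The matrix with its rows already permuted; `fill` holds the entries less one, as labellings do.
  entry : Matrix p m
  entry i j = suc (toℕ (Bijection.to fill (i , j)))

  -- The elements of the join in the order of their labels: first those of `G`, then the cross
  -- edges, then the vertices of the null graph.
  Slot : Set
  Slot = (Fin p ⊎ Edge G) ⊎ ((Fin p × Fin m) ⊎ Fin m)

  -- Passes from the order by labels to the grouping into vertices and edges that a labelling
  -- requires.
  slots : Slot ↔ (Fin (p + m) ⊎ Edge J)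
  slots = (↔-sym Fin.+↔⊎ ⊎-↔ joinEdges G m) ↔-∘ mk↔ₛ′ regroup ungroup
    (λ { (inj₁ (inj₁ _)) → refl ; (inj₁ (inj₂ _)) → refl ; (inj₂ (inj₁ _)) → refl ; (inj₂ (inj₂ _)) → refl })
    (λ { (inj₁ (inj₁ _)) → refl ; (inj₁ (inj₂ _)) → refl ; (inj₂ (inj₁ _)) → refl ; (inj₂ (inj₂ _)) → refl })
    where
    regroup : Slot → (Fin p ⊎ Fin m) ⊎ (Edge G ⊎ (Fin p × Fin m))
    regroup (inj₁ (inj₁ u)) = inj₁ (inj₁ u)
    regroup (inj₁ (inj₂ e)) = inj₂ (inj₁ e)
    regroup (inj₂ (inj₁ x)) = inj₂ (inj₂ x)
    regroup (inj₂ (inj₂ j)) = inj₁ (inj₂ j)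

    ungroup : (Fin p ⊎ Fin m) ⊎ (Edge G ⊎ (Fin p × Fin m)) → Slot
    ungroup (inj₁ (inj₁ u)) = inj₁ (inj₁ u)
    ungroup (inj₁ (inj₂ j)) = inj₂ (inj₂ j)
    ungroup (inj₂ (inj₁ e)) = inj₁ (inj₂ e)
    ungroup (inj₂ (inj₂ x)) = inj₂ (inj₁ x)

  total : (p + q) + (p * m + m) ≡ (p + m) + size J
  total = trans (rearrange p q (p * m) m) (cong (_+_ (p + m)) (sym (size-join G m)))
    where
    rearrange : ∀ a b c d → (a + b) + (c + d) ≡ (a + d) + (b + c)
    rearrange = solve-∀

  numbering : Slot ↔ Fin ((p + m) + size J)
  numbering = Perm.cast-id total ↔-∘ (↔-sym Fin.+↔⊎ ↔-∘
    (⤖⇒↔ g ⊎-↔ (↔-sym Fin.+↔⊎ ↔-∘ (⤖⇒↔ fill ⊎-↔ ↔-id _))))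

  labelling : TotalLabelling J
  labelling = ↔⇒⤖ (numbering ↔-∘ ↔-sym slots)

  label : Fin (p + m) ⊎ Edge J → ℕ
  label x = suc (toℕ (Bijection.to labelling x))

  label-slot : ∀ z → label (Inverse.to slots z) ≡ suc (toℕ (Inverse.to numbering z))
  label-slot z = cong (λ z′ → suc (toℕ (Inverse.to numbering z′))) (Inverse.strictlyInverseʳ slots z)

  label-old : ∀ x → label (Inverse.to slots (inj₁ x)) ≡ suc (toℕ (Bijection.to g x))
  label-old x = trans (label-slot (inj₁ x)) (cong suc
    (trans (Fin.toℕ-cast total _) (Fin.toℕ-↑ˡ (Bijection.to g x) _)))

  label-cross : ∀ i j → label (Inverse.to slots (inj₂ (inj₁ (i , j)))) ≡ p + q + entry i j
  label-cross i j = trans (label-slot (inj₂ (inj₁ (i , j)))) (trans (cong suc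
    (trans (Fin.toℕ-cast total _) (trans (Fin.toℕ-↑ʳ (p + q) _) (cong (_+_ (p + q)) (Fin.toℕ-↑ˡ _ m)))))
    (sym (+-suc (p + q) _)))

  label-apex : ∀ j → label (Inverse.to slots (inj₂ (inj₂ j))) ≡ p + q + p * m + suc (toℕ j)
  label-apex j = trans (label-slot (inj₂ (inj₂ j))) (trans (cong suc
    (trans (Fin.toℕ-cast total _) (trans (Fin.toℕ-↑ʳ (p + q) _)
      (trans (cong (_+_ (p + q)) (Fin.toℕ-↑ʳ (p * m) j)) (sym (+-assoc (p + q) (p * m) (toℕ j)))))))
    (sym (+-suc (p + q + p * m) (toℕ j))))

  contribution-old : ∀ u x (d : Dec (Graph.Adj J (u ↑ˡ m) (x ↑ˡ m))) (d′ : Dec (Graph.Adj G u x)) →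
                     contribution labelling (u ↑ˡ m) (x ↑ˡ m) d ≡ contribution g u x d′
  contribution-old u x d (yes ux) = trans
    (contribution-adjacent labelling d (adjacent⁺ G m (inj₁ u) (inj₁ x) ux)
      (joinEdge G m (inj₁ (edge G u x ux))) (joinEdge-joinsˡ G m (edge G u x ux) (edge-joins u x ux)))
    (cong₂ _+_ (label-old (inj₂ (edge G u x ux))) (label-old (inj₁ x)))
  contribution-old u x d (no ¬ux) =
    contribution-nonadjacent labelling d (¬ux ∘ adjacent⁻ G m (inj₁ u) (inj₁ x))

  -- The neighbours inside `G` contribute the old colour, since `G` keeps its labels; every vertex
  -- of the null graph is a further neighbour.
  inducedColour-left : ∀ u → inducedColour labelling (u ↑ˡ m) ≡
    inducedColour g u + ∑ (λ j → (p + q + entry u j) + (p + q + p * m + suc (toℕ j)))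
  inducedColour-left u = trans (∑-++ p _) (cong₂ _+_
    (Sum.sum-cong-≗ λ x → contribution-old u x (Graph.adj? J (u ↑ˡ m) (x ↑ˡ m)) (Graph.adj? G u x))
    (Sum.sum-cong-≗ λ j → trans
      (contribution-adjacent labelling (Graph.adj? J (u ↑ˡ m) (p ↑ʳ j)) (adjacent⁺ G m (inj₁ u) (inj₂ j) tt)
        (joinEdge G m (inj₂ (u , j))) (inj₁ (refl , refl)))
      (cong₂ _+_ (label-cross u j) (label-apex j))))

  inducedColour-right : ∀ j → inducedColour labelling (p ↑ʳ j) ≡ ∑ (λ i → (p + q + entry i j) + vertexLabel g i)
  inducedColour-right j = trans (∑-++ p _) (trans (cong₂ _+_
    (Sum.sum-cong-≗ λ i → trans
      (contribution-adjacent labelling (Graph.adj? J (p ↑ʳ j) (i ↑ˡ m)) (adjacent⁺ G m (inj₂ j) (inj₁ i) tt)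
        (joinEdge G m (inj₂ (i , j))) (inj₂ (refl , refl)))
      (cong₂ _+_ (label-cross i j) (label-old (inj₁ i))))
    (trans (Sum.sum-cong-≗ λ j′ → contribution-nonadjacent labelling
             (Graph.adj? J (p ↑ʳ j) (p ↑ʳ j′)) (adjacent⁻ G m (inj₂ j) (inj₂ j′)))
           (Sum.sum-replicate-zero m)))
    (+-identityʳ _))

  -- Only the old colour and the row sum depend on `u`: the offsets and the labels of the null graph
  -- add the same amount at every vertex.
  leftColour : ∀ u → inducedColour labelling (u ↑ˡ m) ≡
    inducedColour g u + rowSum entry u + m * (2 * p + 2 * q + p * m) + m * (m + 1) / 2
  leftColour u = begin
    inducedColour labelling (u ↑ˡ m)
      ≡⟨ inducedColour-left u ⟩
    inducedColour g u + ∑ (λ j → (p + q + entry u j) + (p + q + p * m + suc (toℕ j)))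
      ≡⟨ cong (_+_ (inducedColour g u)) (Sum.∑-distrib-+ (λ j → p + q + entry u j) (λ j → p + q + p * m + suc (toℕ j))) ⟩
    inducedColour g u + (∑ (λ j → p + q + entry u j) + ∑ {m} (λ j → p + q + p * m + suc (toℕ j)))
      ≡⟨ cong (_+_ (inducedColour g u)) (cong₂ _+_ (∑-shift (p + q) (entry u)) (∑-shift {m} (p + q + p * m) (λ j → suc (toℕ j)))) ⟩
    inducedColour g u + (m * (p + q) + rowSum entry u + (m * (p + q + p * m) + ∑ {m} (λ j → suc (toℕ j))))
      ≡⟨ cong (λ S → inducedColour g u + (m * (p + q) + rowSum entry u + (m * (p + q + p * m) + S))) (∑-suc-toℕ m) ⟩
    inducedColour g u + (m * (p + q) + rowSum entry u + (m * (p + q + p * m) + m * (m + 1) / 2))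
      ≡⟨ collect (inducedColour g u) m p q (rowSum entry u) (m * (m + 1) / 2) ⟩
    inducedColour g u + rowSum entry u + m * (2 * p + 2 * q + p * m) + m * (m + 1) / 2 ∎
    where
    open ≡-Reasoning
    collect : ∀ c m p q r t → c + (m * (p + q) + r + (m * (p + q + p * m) + t)) ≡ c + r + m * (2 * p + 2 * q + p * m) + t
    collect = solve-∀

  -- The neighbours are all the vertices of `G`, so `j` enters only through its column sum, which is
  -- constant in the application.
  rightColour : ∀ j → inducedColour labelling (p ↑ʳ j) ≡ ∑ (vertexLabel g) + columnSum entry j + p * (p + q)
  rightColour j = begin
    inducedColour labelling (p ↑ʳ j)
      ≡⟨ inducedColour-right j ⟩
    ∑ (λ i → (p + q + entry i j) + vertexLabel g i)
      ≡⟨ Sum.∑-distrib-+ (λ i → p + q + entry i j) (vertexLabel g) ⟩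
    ∑ (λ i → p + q + entry i j) + ∑ (vertexLabel g)
      ≡⟨ cong (_+ ∑ (vertexLabel g)) (∑-shift (p + q) (λ i → entry i j)) ⟩
    p * (p + q) + columnSum entry j + ∑ (vertexLabel g)
      ≡⟨ collect (p * (p + q)) (columnSum entry j) (∑ (vertexLabel g)) ⟩
    ∑ (vertexLabel g) + columnSum entry j + p * (p + q) ∎
    where
    open ≡-Reasoning
    collect : ∀ a b c → a + b + c ≡ c + b + a
    collect = solve-∀

-- Matching the rows of the matrix with the vertices.

record ArithmeticEnumeration {n t} (π : Fin n → Fin t) (c : Fin n → ℤ) (l : Fin t) (a d : ℤ) (k : ℕ) : Set where
  field
    element    : Fin k → Fin n
    injective  : Injective _≡_ _≡_ element
    inBlock    : ∀ i → π (element i) ≡ l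
    covers     : ∀ u → π u ≡ l → ∃[ i ] element i ≡ u
    value      : ∀ i → c (element i) ≡ a ℤ.+ + toℕ i ℤ.* d

-- The permutation of values lifts to a reordering `us` of the block whose values are the
-- progression in order. Injectivity comes from `us` having no repetition, so equal terms (step 0)
-- do no harm.
arithmeticEnumeration : ∀ {n t} (π : Fin n → Fin t) (c : Fin n → ℤ) l a d k →
                        map c (block π l) ↭ arithmeticSequence a d k → ArithmeticEnumeration π c l a d k
arithmeticEnumeration {n} π c l a d k perm with ↭-map-inv c perm
... | us , terms≡ , block↭us = record
  { element   = λ i → lookup us (Fin.cast k≡ i)
  ; injective = λ {i} {j} eq → Fin.toℕ-injective (trans (sym (Fin.toℕ-cast k≡ i))
      (trans (cong toℕ (lookup-injective us-unique eq)) (Fin.toℕ-cast k≡ j)))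
  ; inBlock   = λ i → proj₂ (∈-filter⁻ inBlock? {xs = allFin n} (∈-resp-↭ (↭-sym block↭us) (∈-lookup {xs = us} _)))
  ; covers    = λ u πu≡l → let u∈us = ∈-resp-↭ block↭us (∈-filter⁺ inBlock? (∈-allFin u) πu≡l) in
      Fin.cast (sym k≡) (index u∈us) ,
      trans (cong (lookup us) (Fin.cast-involutive k≡ (sym k≡) (index u∈us))) (sym (lookup-index u∈us))
  ; value     = λ i → trans
      (lookup-map-≡ {f = c} {λ i → a ℤ.+ + i ℤ.* d} (sym terms≡) (Fin.cast k≡ i) (Fin.cast (sym (length-upTo k)) i)
        (trans (Fin.toℕ-cast k≡ i) (sym (Fin.toℕ-cast (sym (length-upTo k)) i))))
      (cong (λ i → a ℤ.+ + i ℤ.* d) (trans (lookup-upTo k _) (Fin.toℕ-cast (sym (length-upTo k)) i)))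
  }
  where
  inBlock? : Decidable (λ u → π u ≡ l)
  inBlock? u = π u Fin.≟ l

  us-unique : Unique us
  us-unique = ↭ₛ.Unique-resp-↭ (setoid _) (↭⇒↭ₛ block↭us) (Unique.filter⁺ inBlock? (Unique.allFin⁺ n))

  k≡ : k ≡ length us
  k≡ = trans (sym (length-upTo k)) (trans (sym (length-map _ (upTo k)))
    (trans (cong length terms≡) (length-map c us)))

-- Matching the i-th term of α l, α l + d l, … with the i-th term of
-- β l, β l − d l, … makes all the sums of a block equal to α l + β l.
matching : ∀ {n t} (π ρ : Fin n → Fin t) (c r : Fin n → ℤ) (α β d : Fin t → ℤ) (s : Fin t → ℕ) →
           (∀ l → map c (block π l) ↭ arithmeticSequence (α l) (d l) (s l)) →
           (∀ l → map r (block ρ l) ↭ arithmeticSequence (β l) (ℤ.- d l) (s l)) →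
           ∃[ σ ] Injective _≡_ _≡_ σ × (∀ u → c u ℤ.+ r (σ u) ≡ α (π u) ℤ.+ β (π u))
matching {n} {t} π ρ c r α β d s c-perm r-perm = σ , σ-injective , sums
  where
  module C l = ArithmeticEnumeration (arithmeticEnumeration π c l (α l) (d l) (s l) (c-perm l))
  module R l = ArithmeticEnumeration (arithmeticEnumeration ρ r l (β l) (ℤ.- d l) (s l) (r-perm l))

  position : ∀ u → Fin (s (π u))
  position u = proj₁ (C.covers (π u) u refl)

  at-position : ∀ u → C.element (π u) (position u) ≡ u
  at-position u = proj₂ (C.covers (π u) u refl)

  σ : Fin n → Fin n
  σ u = R.element (π u) (position u)

  transfer : ∀ {l l′} → l ≡ l′ → ∀ i i′ → R.element l i ≡ R.element l′ i′ → C.element l i ≡ C.element l′ i′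
  transfer refl i i′ eq = cong (C.element _) (R.injective _ eq)

  σ-injective : Injective _≡_ _≡_ σ
  -- The row `σ u` lies in the collection with index `π u`, so equal rows come from the same partite
  -- set, where `R.injective` applies.
  σ-injective {u} {v} eq = trans (sym (at-position u))
    (trans (transfer (trans (sym (R.inBlock (π u) _)) (trans (cong ρ eq) (R.inBlock (π v) _))) _ _ eq) (at-position v))

  sums : ∀ u → c u ℤ.+ r (σ u) ≡ α (π u) ℤ.+ β (π u)
  sums u = trans (cong₂ ℤ._+_ (trans (cong c (sym (at-position u))) (C.value (π u) _)) (R.value (π u) _))
    (cancel (α (π u)) (β (π u)) (+ toℕ (position u)) (d (π u)))
    where
    cancel : ∀ a b i d → (a ℤ.+ i ℤ.* d) ℤ.+ (b ℤ.+ i ℤ.* (ℤ.- d)) ≡ a ℤ.+ b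
    cancel = ℤRing.solve-∀

-- The `p * m` cells hit every value in the range, so each value occurs exactly once; permuting the
-- rows preserves this.
cells : ∀ {p m} (A : Matrix p m) → (∀ k → (∃[ i ] ∃[ j ] A i j ≡ k) ⇔ (1 ≤ k × k ≤ p * m)) →
        (σ : Fin p → Fin p) → Injective _≡_ _≡_ σ →
        Σ ((Fin p × Fin m) ⤖ Fin (p * m)) λ fill → ∀ i j → suc (toℕ (Bijection.to fill (i , j))) ≡ A (σ i) j
cells {p} {m} A entries σ σ-injective = surjective⇒⤖ Fin.*↔× (λ (i , j) → cell (σ i) j) surj , λ i → cell-label (σ i)
  where
  predecessor : ∀ k → 1 ≤ k × k ≤ p * m → Σ (Fin (p * m)) λ c → suc (toℕ c) ≡ k
  predecessor (suc k) (_ , k<pm) = fromℕ< k<pm , cong suc (Fin.toℕ-fromℕ< k<pm)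

  located : ∀ i j → Σ (Fin (p * m)) λ c → suc (toℕ c) ≡ A i j
  located i j = predecessor (A i j) (Equivalence.to (entries (A i j)) (i , j , refl))

  cell : Fin p → Fin m → Fin (p * m)
  cell i j = proj₁ (located i j)

  cell-label : ∀ i j → suc (toℕ (cell i j)) ≡ A i j
  cell-label i j = proj₂ (located i j)

  surj : StrictlySurjective _≡_ (λ (i , j) → cell (σ i) j)
  surj y with Equivalence.from (entries (suc (toℕ y))) (s≤s z≤n , Fin.toℕ<n y)
  ... | i , j , Aij≡ with injective⇒surjective σ-injective i
  ...   | i′ , σi′≡i = (i′ , j) , Fin.toℕ-injective (suc-injective
          (trans (cell-label (σ i′) j) (trans (cong (λ i → A i j) σi′≡i) Aij≡)))

-- Upper and lower bounds for the chromatic number of the join.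

antimagic-by-classes : ∀ {n k} {G : Graph n} (f : TotalLabelling G) (class : Fin n → Fin k) (κ : Fin k → ℤ) →
                       Injective _≡_ _≡_ κ → (∀ x → + inducedColour f x ≡ κ (class x)) → ProperColouring G class →
                       IsLocalTotalNeighbourhoodAntimagic f × colourCount f ≤ k
antimagic-by-classes f class κ κ-injective colour class-proper =
  -- Distinct classes get distinct colours because `κ` is injective, and equal classes get equal
  -- colours.
  (λ x y xy eq → class-proper x y xy (κ-injective (trans (sym (colour x)) (trans (cong +_ eq) (colour y))))) ,
  colourCount-≤ f class (λ {x} {y} eq → ℤ.+-injective (trans (colour x) (trans (cong κ eq) (sym (colour y)))))

ltnaChromaticNumber-join : ∀ {p m t} (G : Graph p) → 1 ≤ m → (f : TotalLabelling (G ∨ O m)) →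
                           IsLocalTotalNeighbourhoodAntimagic f → colourCount f ≤ t + 1 →
                           (∃[ k ] IsLtnaChromaticNumber (G ∨ O m) k × k ≤ t + 1) ×
                           (IsChromaticNumber G t → IsLtnaChromaticNumber (G ∨ O m) (t + 1))
ltnaChromaticNumber-join {p} {m} {t} G 1≤m f antimagic count≤ = bounded , exact
  where
  bounded : ∃[ k ] IsLtnaChromaticNumber (G ∨ O m) k × k ≤ t + 1
  -- The count of `f` starts the search, so the minimum found cannot exceed it.
  bounded with minimum (attainable? (G ∨ O m)) (colourCount f) (f , antimagic , refl)
  ... | k , isMin , k≤count = k , isMin , ≤-trans k≤count count≤

  exact : IsChromaticNumber G t → IsLtnaChromaticNumber (G ∨ O m) (t + 1)
  exact (_ , t-minimal) =
    (f , antimagic , ≤-antisym count≤ (lower f antimagic)) , λ { _ (f′ , antimagic′ , refl) → lower f′ antimagic′ }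
    where
    lower : (f : TotalLabelling (G ∨ O m)) → IsLocalTotalNeighbourhoodAntimagic f → t + 1 ≤ colourCount f
    lower f antimagic with colourable-join G m 1≤m (antimagic⇒colourable f antimagic)
    ... | k , count≡ , G-colourable = subst₂ _≤_ (+-comm 1 t) (sym count≡) (s≤s (t-minimal k G-colourable))

joinLabelling-antimagic :
  ∀ {p m t} {G : Graph p} (g : TotalLabelling G) (fill : (Fin p × Fin m) ⤖ Fin (p * m)) →
  let open JoinLabelling g fill in
  (π : Fin p → Fin t) → ProperColouring G π →
  (γ : Fin t → ℤ) → Injective _≡_ _≡_ γ → (∀ u → + inducedColour g u ℤ.+ + rowSum entry u ≡ γ (π u)) →
  (c : ℕ) → (∀ j → columnSum entry j ≡ c) →
  (∀ l → γ l ℤ.+ + (m * (2 * p + 2 * size G + p * m)) ℤ.+ + (m * (m + 1) / 2)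
         ≢ + (∑ (vertexLabel g) + c + p * (p + size G))) →
  IsLocalTotalNeighbourhoodAntimagic labelling × colourCount labelling ≤ suc t
joinLabelling-antimagic {p} {m} {t} {G} g fill π π-proper γ γ-injective γ-rows c columns right-distinct =
  antimagic-by-classes labelling (λ x → class (splitAt p x)) κ κ-injective
    (λ x → trans (cong (λ y → + inducedColour labelling y) (sym (Fin.join-splitAt p m x))) (colour-class (splitAt p x)))
    (λ x y → class-proper (splitAt p x) (splitAt p y))
  where
  open JoinLabelling g fill

  shift₁ = m * (2 * p + 2 * size G + p * m)
  shift₂ = m * (m + 1) / 2

  -- Class `zero` is the null graph and class `suc l` the partite set with index `l`; `κ` gives
  -- their colours.
  κ : Fin (suc t) → ℤ
  κ zero    = + (∑ (vertexLabel g) + c + p * (p + size G))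
  κ (suc l) = γ l ℤ.+ + shift₁ ℤ.+ + shift₂

  κ-injective : Injective _≡_ _≡_ κ
  κ-injective {zero}  {zero}   _  = refl
  -- Condition (ii) separates the null graph from `G`; condition (i) separates the partite sets from
  -- one another.
  κ-injective {zero}  {suc l}  eq = contradiction (sym eq) (right-distinct l)
  κ-injective {suc l} {zero}   eq = contradiction eq (right-distinct l)
  κ-injective {suc l} {suc l′} eq =
    cong suc (γ-injective (ℤ+.∙-cancelʳ (+ shift₁) _ _ (ℤ+.∙-cancelʳ (+ shift₂) _ _ eq)))

  class : Fin p ⊎ Fin m → Fin (suc t)
  class (inj₁ u) = suc (π u)
  class (inj₂ _) = zero

  class-proper : ∀ z z′ → JoinAdj G (O m) z z′ → class z ≢ class z′
  class-proper (inj₁ u) (inj₁ v) uv eq = π-proper u v uv (Fin.suc-injective eq)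
  class-proper (inj₁ _) (inj₂ _) _  ()
  class-proper (inj₂ _) (inj₁ _) _  ()
  class-proper (inj₂ _) (inj₂ _) ()

  +-homo : ∀ a b c d → + (a + b + c + d) ≡ + a ℤ.+ + b ℤ.+ + c ℤ.+ + d
  +-homo _ _ _ _ = refl

  colour-class : ∀ z → + inducedColour labelling (join p m z) ≡ κ (class z)
  colour-class (inj₁ u) = begin
    + inducedColour labelling (u ↑ˡ m)
      ≡⟨ cong +_ (leftColour u) ⟩
    + (inducedColour g u + rowSum entry u + shift₁ + shift₂)
      ≡⟨ +-homo (inducedColour g u) (rowSum entry u) shift₁ shift₂ ⟩
    + inducedColour g u ℤ.+ + rowSum entry u ℤ.+ + shift₁ ℤ.+ + shift₂
      ≡⟨ cong (λ z → z ℤ.+ + shift₁ ℤ.+ + shift₂) (γ-rows u) ⟩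
    κ (suc (π u)) ∎
    where open ≡-Reasoning
  colour-class (inj₂ j) = cong +_ (trans (rightColour j)
    (cong (λ c → ∑ (vertexLabel g) + c + p * (p + size G)) (columns j)))

theorem2p1 : ∀ (p q m : ℕ) → 2 ≤ p → 2 ∣ p → 3 ≤ m → ¬ (2 ∣ m) →
    (G : Graph p) → size G ≡ q →
    (t : ℕ) → 2 ≤ t →
    -- (a): π u is the index l of the partite set V_l containing u
    (s : Fin t → ℕ) →
    (∀ l → 1 ≤ s l) →
    (∀ l l′ → toℕ l′ ≡ suc (toℕ l) → s l ≤ s l′) →
    (π : Fin p → Fin t) →
    ProperColouring G π →
    (∀ l → length (block π l) ≡ s l) →
    -- (b)
    (α β d : Fin t → ℤ) →
    (g : TotalLabelling G) →
    (∀ l → map (λ u → + inducedColour g u) (block π l) ↭ arithmeticSequence (α l) (d l) (s l)) →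
    -- (A): ρ i is the index l of the collection S_l containing the sum of row i
    (A : Matrix p m) →
    (∀ k → (∃[ i ] ∃[ j ] A i j ≡ k) ⇔ (1 ≤ k × k ≤ p * m)) →
    (∀ j → columnSum A j ≡ p * (p * m + 1) / 2) →
    (ρ : Fin p → Fin t) →
    (∀ l → length (block ρ l) ≡ s l) →
    (∀ l → map (λ i → + rowSum A i) (block ρ l) ↭ arithmeticSequence (β l) (ℤ.- d l) (s l)) →
    -- (i)
    (∀ l l′ → toℕ l < toℕ l′ → α l ℤ.+ β l ≢ α l′ ℤ.+ β l′) →
    -- (ii)
    (∀ l → α l ℤ.+ β l ℤ.+ + (m * (2 * p + 2 * q + p * m)) ℤ.+ + (m * (m + 1) / 2)
           ≢ + (∑ (vertexLabel g) + p * (p * m + 1) / 2 + p * (p + q))) →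
    (∃[ k ] IsLtnaChromaticNumber (G ∨ O m) k × k ≤ t + 1) ×
    (IsChromaticNumber G t → IsLtnaChromaticNumber (G ∨ O m) (t + 1))
theorem2p1 p q m 2≤p 2∣p 3≤m 2∤m G refl t 2≤t s 1≤s s-mono π π-proper π-sizes α β d g g-colours
  A A-entries A-columns ρ ρ-sizes A-rows α+β-distinct right-distinct
  = ltnaChromaticNumber-join G (≤-trans (s≤s z≤n) 3≤m) (JoinLabelling.labelling g fill)
      (proj₁ antimagic) (≤-trans (proj₂ antimagic) (≤-reflexive (+-comm 1 t)))
  where
  matched = matching π ρ (λ u → + inducedColour g u) (λ i → + rowSum A i) α β d s g-colours A-rows
  σ = proj₁ matched
  σ-injective = proj₁ (proj₂ matched)
  sums = proj₂ (proj₂ matched)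
  fill = proj₁ (cells A A-entries σ σ-injective)
  fill-label = proj₂ (cells A A-entries σ σ-injective)

  γ-injective : Injective _≡_ _≡_ (λ l → α l ℤ.+ β l)
  γ-injective {l} {l′} eq with Fin.<-cmp l l′
  ... | tri< l<l′ _ _ = contradiction eq (α+β-distinct l l′ l<l′)
  ... | tri≈ _ l≡l′ _ = l≡l′
  ... | tri> _ _ l′<l = contradiction (sym eq) (α+β-distinct l′ l l′<l)

  -- Rearranging the rows only permutes the summands of each column, so the column sums keep their
  -- common value.
  σ-permutation : Perm.Permutation p p
  σ-permutation = ⤖⇒↔ (mk⤖ₛ σ σ-injective (injective⇒surjective σ-injective))

  antimagic = joinLabelling-antimagic g fill π π-proper (λ l → α l ℤ.+ β l) γ-injective
    (λ u → trans (cong (λ r → + inducedColour g u ℤ.+ + r) (Sum.sum-cong-≗ (fill-label u))) (sums u))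
    (p * (p * m + 1) / 2)
    (λ j → trans (Sum.sum-cong-≗ (λ i → fill-label i j))
      (trans (sym (Sum.sum-permute (λ i → A i j) σ-permutation)) (A-columns j)))
    right-distinct
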